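{- Let $S = \{ \boldsymbol{x}_1,\dots,\boldsymbol{x}_k \} \subset \mathbb{R}^n$ be a collection of $k > n$ points, let $m, l \geq 1$ be integers such that $k = m+l$, let $S = I_m \sqcup J_l$ be a partition of $S$ with $|I_m| = m$ and $|J_l| = l$, and let $D \subseteq \mathcal{D}(I_m,J_l)$. Let $1 \leq \ell \leq n-1$. The following two statements are true: (1) If $S$ cannot be covered by fewer than $k-n+1$ parallel hyperplanes and for every subset $D'$ of $\ell$ vectors of $D$, $g(D') > \ell$, then $A(D)$ is a sensing matrix for $\ell$-sparse vectors. (2) If for every $m+l=k$ (with $m, l \geq 1$) and every partition $S = I_m \sqcup J_l$ with $|I_m| = m$, $|J_l| = l$, the matrix $A(\mathcal{D}(I_m,J_l))$ is a sensing matrix for $n$-sparse vectors, then $S$ cannot be covered by fewer than $k-n+1$ parallel hyperplanes.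
   Context: A hyperplane in $\mathbb{R}^n$ is an affine subspace of dimension $n-1$. "$S$ cannot be covered by fewer than $N$ parallel hyperplanes" means that no collection of fewer than $N$ pairwise parallel hyperplanes has union containing $S$. For a partition $S = I_m \sqcup J_l$ into two disjoint subsets of cardinalities $m, l \geq 1$, define the set of pairwise difference vectors $$\mathcal{D}(I_m,J_l) = \{ \boldsymbol{x}_i - \boldsymbol{x}_j : \boldsymbol{x}_i \in I_m, \boldsymbol{x}_j \in J_l \}.$$ For $D \subseteq \mathcal{D}(I_m,J_l)$, the support of $D$ is the set of all distinct vectors $\boldsymbol{x}_i$ that appear in the differences in $D$. $A(D)$ denotes the matrix whose column vectors are the elements of $D$. $\Gamma(D)$ denotes the bipartite graph whose vertices correspond to the support of $D$, two vertices $\boldsymbol{x}_i, \boldsymbol{x}_j$ being connected by an edge if and only if $\boldsymbol{x}_i - \boldsymbol{x}_j \in D$; in other words, $D$ is the set of edges of $\Gamma(D)$. $g(D)$ denotes the girth of $\Gamma(D)$, i.e. the minimal length of a cycle in $\Gamma(D)$ (infinite if there are no cycles). For $D' \subseteq D$, $g(D')$ is defined in the same way using $\Gamma(D')$. An $n \times d$ real matrix $A$ is a sensing matrix for $\ell$-sparse vectors, $1 \leq \ell \leq n$, if for every nonzero vector $\boldsymbol{x} \in \mathbb{R}^d$ with no more than $\ell$ nonzero coordinates, $A\boldsymbol{x} \neq \boldsymbol{0}$.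
   Formalization: In (1), when D has fewer than ℓ vectors it is additionally assumed that g(D) > ℓ; without this (1) fails, e.g. for 7 affinely independent points in R^6, ℓ = 5 and D the four edges of a 4-cycle, where the girth condition is void. -}

module Defs where

open import Algebra.Core using (Op₁; Op₂)
open import Algebra.Bundles using (CommutativeRing)
open import Algebra.Structures using (IsCommutativeRing)
import Algebra.Properties.Monoid.Sum as Sum
open import Data.Fin using (Fin; zero; suc; inject₁; fromℕ)
open import Data.Fin.Subset using (Subset; ⊤; _∩_; _∪_; Empty)
  renaming (_∈_ to _∈ₛ_)
open import Data.Fin.Subset.Properties using () renaming (_∈?_ to _∈ₛ?_)
open import Data.List using (List; length; lookup; map; filter; allFin; cartesianProductWith; deduplicate)
import Data.List.Membership.Setoid as Membership
import Data.List.Relation.Binary.Subset.Setoid as ListSubset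
import Data.List.Relation.Unary.Unique.Setoid as UniqueSetoid
open import Data.List.Relation.Unary.Unique.DecSetoid.Properties using (deduplicate-!)
open import Data.Nat as ℕ using (ℕ; zero; suc; _∸_)
open import Data.Product using (Σ; ∃; ∃-syntax; _×_; _,_)
open import Data.Sum using (_⊎_; swap)
open import Data.Vec.Functional using (Vector)
import Data.Vec.Functional.Relation.Binary.Pointwise.Properties as Pointwise
open import Function.Definitions using (Injective)
open import Level using (Level; _⊔_) renaming (suc to lsuc)
open import Relation.Binary using (Rel; Symmetric; IsDecTotalOrder; DecSetoid; Setoid)
open import Relation.Binary.Construct.Add.Supremum.Strict ℕ._<_ using (_<⁺_)
open import Relation.Binary.PropositionalEquality using (_≡_)
open import Relation.Nullary using (¬_)
open import Relation.Nullary.Construct.Add.Supremum using (_⁺; [_]; ⊤⁺)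
open import Relation.Nullary.Decidable using (¬?)
open import Relation.Unary using (Pred; Satisfiable; _≐_)

-- The real numbers, given by their classical axioms: a Dedekind-complete
-- ordered field.  As in classical mathematics, equality and order are decidable.
record Reals (c ℓ₁ ℓ₂ : Level) : Set (lsuc (c ⊔ ℓ₁ ⊔ ℓ₂)) where
  infix  4 _≈_ _≤_
  infixl 6 _+_
  infixl 7 _*_
  infix  8 -_
  field
    Carrier : Set c
    _≈_     : Rel Carrier ℓ₁
    _≤_     : Rel Carrier ℓ₂
    _+_ _*_ : Op₂ Carrier
    -_      : Op₁ Carrier
    0# 1#   : Carrier

    isCommutativeRing : IsCommutativeRing _≈_ _+_ _*_ -_ 0# 1#
    0≉1               : ¬ (0# ≈ 1#)
    inverse           : ∀ x → ¬ (x ≈ 0#) → ∃[ y ] (x * y ≈ 1#)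

    isDecTotalOrder   : IsDecTotalOrder _≈_ _≤_
    +-monoʳ-≤         : ∀ z {x y} → x ≤ y → z + x ≤ z + y
    *-nonNeg          : ∀ {x y} → 0# ≤ x → 0# ≤ y → 0# ≤ x * y

  UpperBound : Pred Carrier (c ⊔ ℓ₁ ⊔ ℓ₂) → Pred Carrier (c ⊔ ℓ₁ ⊔ ℓ₂)
  UpperBound P u = ∀ x → P x → x ≤ u

  field
    supremum : ∀ P → Satisfiable P → Satisfiable (UpperBound P) →
               ∃[ s ] (UpperBound P s × (∀ u → UpperBound P u → s ≤ u))

  commutativeRing : CommutativeRing c ℓ₁
  commutativeRing = record { isCommutativeRing = isCommutativeRing }

  open IsDecTotalOrder isDecTotalOrder public using (_≟_; _≤?_)

  decSetoid : DecSetoid c ℓ₁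
  decSetoid = record { isDecEquivalence = IsDecTotalOrder.Eq.isDecEquivalence isDecTotalOrder }

------------------------------------------------------------------------
-- Graphs

-- An undirected graph with vertices among the elements of V.
record Graph {v} (V : Set v) (a : Level) : Set (v ⊔ lsuc a) where
  field
    Vertex : Pred V a
    Adj    : Rel V a
    sym    : Symmetric Adj

-- The vertices vertex 0, …, vertex r form a cycle of length suc r.
record IsCycle {v a} {V : Set v} (G : Graph V a) (r : ℕ)
               (vertex : Fin (suc r) → V) : Set (v ⊔ a) where
  open Graph G
  field
    3≤length : 3 ℕ.≤ suc r
    distinct : Injective _≡_ _≡_ vertex
    vertices : ∀ i → Vertex (vertex i)
    edges    : ∀ (i : Fin r) → Adj (vertex (inject₁ i)) (vertex (suc i))
    closing  : Adj (vertex (fromℕ r)) (vertex zero)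

module _ {v a} {V : Set v} (G : Graph V a) where

  HasCycleOfLength : ℕ → Set (v ⊔ a)
  HasCycleOfLength q = ∃[ r ] (q ≡ suc r × Σ (Fin (suc r) → V) (IsCycle G r))

  -- ℕ ⁺ adjoins the value ∞, written ⊤⁺.
  IsGirth : ℕ ⁺ → Set (v ⊔ a)
  IsGirth [ g ] = HasCycleOfLength g × (∀ q → HasCycleOfLength q → g ℕ.≤ q)
  IsGirth ⊤⁺    = ∀ q → ¬ HasCycleOfLength q

  GirthExceeds : ℕ → Set (v ⊔ a)
  GirthExceeds q = ∃[ g ] (IsGirth g × [ q ] <⁺ g)

------------------------------------------------------------------------
-- Partitions of a set of k indexed points

record IsPartition {k : ℕ} (I J : Subset k) : Set where
  field
    disjoint : Empty (I ∩ J)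
    covering : I ∪ J ≡ ⊤

------------------------------------------------------------------------
-- Geometry of ℝⁿ

module Euclidean {c ℓ₁ ℓ₂ : Level} (ℝ : Reals c ℓ₁ ℓ₂) where

  open Reals ℝ
  open Sum (CommutativeRing.+-monoid commutativeRing) using (sum)

  ℝ^ : ℕ → Set c
  ℝ^ n = Vector Carrier n

  ℝ^-decSetoid : ℕ → DecSetoid c ℓ₁
  ℝ^-decSetoid n = Pointwise.decSetoid decSetoid n

  ℝ^-setoid : ℕ → Setoid c ℓ₁
  ℝ^-setoid n = DecSetoid.setoid (ℝ^-decSetoid n)

  infix  4 _≋_
  infixl 6 _+ᵥ_ _-ᵥ_
  infixl 7 _*ᵥ_ _·_

  _≋_ : ∀ {n} → Rel (ℝ^ n) ℓ₁
  _≋_ {n} = Setoid._≈_ (ℝ^-setoid n)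

  0ᵥ : ∀ {n} → ℝ^ n
  0ᵥ _ = 0#

  _+ᵥ_ : ∀ {n} → Op₂ (ℝ^ n)
  (u +ᵥ v) i = u i + v i

  _-ᵥ_ : ∀ {n} → Op₂ (ℝ^ n)
  (u -ᵥ v) i = u i + - v i

  _*ᵥ_ : ∀ {n} → Carrier → ℝ^ n → ℝ^ n
  (a *ᵥ v) i = a * v i

  Matrix : ℕ → ℕ → Set c
  Matrix n d = Fin n → Fin d → Carrier

  _·_ : ∀ {n d} → Matrix n d → ℝ^ d → ℝ^ n
  (A · x) i = sum (λ j → A i j * x j)

  linearCombination : ∀ {n d} → ℝ^ d → (Fin d → ℝ^ n) → ℝ^ n
  linearCombination a b i = sum (λ j → a j * b j i)

  ----------------------------------------------------------------------
  -- Affine subspaces and hyperplanes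

  record IsLinearSubspace {n} (W : Pred (ℝ^ n) (c ⊔ ℓ₁)) : Set (c ⊔ ℓ₁) where
    field
      resp     : ∀ {u v} → u ≋ v → W u → W v
      0-closed : W 0ᵥ
      +-closed : ∀ {u v} → W u → W v → W (u +ᵥ v)
      *-closed : ∀ a {v} → W v → W (a *ᵥ v)

  LinearlyIndependent : ∀ {n d} → (Fin d → ℝ^ n) → Set (c ⊔ ℓ₁)
  LinearlyIndependent b = ∀ a → linearCombination a b ≋ 0ᵥ → a ≋ 0ᵥ

  record IsBasis {n d} (W : Pred (ℝ^ n) (c ⊔ ℓ₁)) (b : Fin d → ℝ^ n) : Set (c ⊔ ℓ₁) where
    field
      members     : ∀ i → W (b i)
      independent : LinearlyIndependent b
      spanning    : ∀ v → W v → ∃[ a ] (linearCombination a b ≋ v)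

  HasDimension : ∀ {n} → Pred (ℝ^ n) (c ⊔ ℓ₁) → ℕ → Set (c ⊔ ℓ₁)
  HasDimension {n} W d = Σ (Fin d → ℝ^ n) (IsBasis W)

  record AffineSubspace (n d : ℕ) : Set (lsuc (c ⊔ ℓ₁)) where
    field
      point            : ℝ^ n
      direction        : Pred (ℝ^ n) (c ⊔ ℓ₁)
      isLinearSubspace : IsLinearSubspace direction
      dimension        : HasDimension direction d

  infix 4 _∈ₐ_ _∥_

  _∈ₐ_ : ∀ {n d} → ℝ^ n → AffineSubspace n d → Set (c ⊔ ℓ₁)
  v ∈ₐ H = direction (v -ᵥ point)
    where open AffineSubspace H

  -- Truncated subtraction: only meaningful for n ≥ 1.
  Hyperplane : ℕ → Set (lsuc (c ⊔ ℓ₁))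
  Hyperplane n = AffineSubspace n (n ∸ 1)

  _∥_ : ∀ {n d} → Rel (AffineSubspace n d) (c ⊔ ℓ₁)
  H ∥ H′ = AffineSubspace.direction H ≐ AffineSubspace.direction H′

  CoveredByParallelHyperplanes : ∀ {n k} → (Fin k → ℝ^ n) → ℕ → Set (lsuc (c ⊔ ℓ₁))
  CoveredByParallelHyperplanes {n} x N =
    Σ (Fin N → Hyperplane n) λ H →
      (∀ i j → H i ∥ H j) × (∀ p → ∃[ i ] (x p ∈ₐ H i))

  NotCoveredByFewerThan : ∀ {n k} → (Fin k → ℝ^ n) → ℕ → Set (lsuc (c ⊔ ℓ₁))
  NotCoveredByFewerThan x N = ∀ N′ → N′ ℕ.< N → ¬ CoveredByParallelHyperplanes x N′

  ----------------------------------------------------------------------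
  -- Finite sets of vectors

  record FiniteSet (n : ℕ) : Set (c ⊔ ℓ₁) where
    open UniqueSetoid (ℝ^-setoid n) using (Unique)
    field
      elements : List (ℝ^ n)
      unique   : Unique elements

  open FiniteSet public

  infix 4 _∈_ _⊆_

  _∈_ : ∀ {n} → ℝ^ n → FiniteSet n → Set (c ⊔ ℓ₁)
  _∈_ {n} v D = v ∈ₗ elements D
    where open Membership (ℝ^-setoid n) renaming (_∈_ to _∈ₗ_)

  _⊆_ : ∀ {n} → Rel (FiniteSet n) (c ⊔ ℓ₁)
  _⊆_ {n} D D′ = elements D ⊆ₗ elements D′
    where open ListSubset (ℝ^-setoid n) renaming (_⊆_ to _⊆ₗ_)

  card : ∀ {n} → FiniteSet n → ℕ
  card D = length (elements D)

  A : ∀ {n} (D : FiniteSet n) → Matrix n (card D)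
  A D i j = lookup (elements D) j i

  -- Distinct pairs (xᵢ , xⱼ) may have the same difference, which is then
  -- a single element of 𝒟 and a single column of A 𝒟.
  𝒟 : ∀ {n k} → (Fin k → ℝ^ n) → Subset k → Subset k → FiniteSet n
  𝒟 {n} {k} x I J = record
    { elements = deduplicate _≟ᵥ_ differences
    ; unique   = deduplicate-! (ℝ^-decSetoid n) differences
    }
    where
    open DecSetoid (ℝ^-decSetoid n) using () renaming (_≟_ to _≟ᵥ_)
    points : Subset k → List (ℝ^ n)
    points T = map x (filter (_∈ₛ? T) (allFin k))
    differences : List (ℝ^ n)
    differences = cartesianProductWith _-ᵥ_ (points I) (points J)

  -- Vertices are represented by the indices of the points, which are
  -- pairwise distinct wherever Γ is used.
  Γ : ∀ {n k} → (Fin k → ℝ^ n) → Subset k → Subset k → FiniteSet n →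
      Graph (Fin k) (c ⊔ ℓ₁)
  Γ {k = k} x I J D = record
    { Vertex = λ i → ∃[ j ] (Appears i j ⊎ Appears j i)
    ; Adj    = λ i j → Appears i j ⊎ Appears j i
    ; sym    = swap
    }
    where
    Appears : Rel (Fin k) (c ⊔ ℓ₁)
    Appears i j = i ∈ₛ I × j ∈ₛ J × (x i -ᵥ x j) ∈ D

  ----------------------------------------------------------------------
  -- Sparse vectors and sensing matrices

  nonzeroCoordinates : ∀ {d} → ℝ^ d → ℕ
  nonzeroCoordinates {d} x = length (filter (λ i → ¬? (x i ≟ 0#)) (allFin d))

  IsSensing : ∀ {n d} → ℕ → Matrix n d → Set (c ⊔ ℓ₁)
  IsSensing {n} {d} s M =
    ∀ (x : ℝ^ d) → ¬ (x ≋ 0ᵥ) → nonzeroCoordinates x ℕ.≤ s → ¬ (M · x ≋ 0ᵥ)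

{-# OPTIONS --safe #-}
module Submission where

-- (1) Choose for every column in the support of a relation a pair of points
-- realising it.  Without short cycles these s ≤ n - 1 edges form a forest, and
-- joining components one gets n edges with k - n components.  One edge vector
-- depends on the others, so n - 1 linear equations yield a nonzero functional
-- that is constant on each component; its level sets are k - n parallel
-- hyperplanes covering S.
--
-- (2) If N ≤ k - n parallel hyperplanes cover S, choose a representative in each
-- nonempty one and let I consist of the other points, of which there are at least
-- n.  Their differences with their representatives lie in a space of dimension
-- n - 1, so n of them are dependent, and they are distinct columns unless two
-- disjoint pairs of points have the same difference u; in that case another
-- partition has both u and - u among its columns.

open import Defs
open import Algebra.Bundles using (CommutativeRing)
import Algebra.Properties.AbelianGroup as AbelianGroupProperties
import Algebra.Properties.Ring as RingProperties
import Algebra.Properties.Semiring.Sum as SemiringSum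
open import Data.Fin using (Fin; zero; suc; toℕ; inject₁; inject≤; fromℕ; fromℕ<; punchIn; punchOut; join; splitAt)
open import Data.Fin.Properties using
  (_≟_; any?; injective⇒≤; suc-injective; inject₁-injective; inject≤-injective; toℕ-inject₁; splitAt-join;
   punchIn-punchOut; punchInᵢ≢i; punchOut-cong; punchOut-punchIn; punchOut-injective; ¬∀⟶∃¬)
open import Data.Fin.Subset using (Subset; ∣_∣; _∩_; _∪_; ∁; ⁅_⁆; Empty) renaming (_∈_ to _∈ₛ_; _∉_ to _∉ₛ_)
open import Data.Fin.Subset.Properties using
  (∣∁p∣≡n∸∣p∣; ∣p∣≤n; p∪∁p≡⊤; x∈p∩q⁺; x∈p∩q⁻; x∈p∪q⁺; x∈p∪q⁻; x∈⁅x⁆; x∈⁅y⁆⇒x≡y; x∈p⇒∣p-x∣<∣p∣; x∈p⇒x∉∁p; x∉p⇒x∈∁p)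
  renaming (_∈?_ to _∈ₛ?_)
open import Data.List using (List; []; _∷_; length; lookup; map; filter; allFin)
import Data.List.Membership.DecPropositional as DecMembership
open import Data.List.Membership.Propositional using (_∈_)
open import Data.List.Membership.Propositional.Properties using (∈-lookup; ∈-allFin; ∈-filter⁺; ∈-filter⁻; ∈-map⁺; ∈-map⁻)
import Data.List.Membership.Setoid.Properties as ∈ₛ
open import Data.List.Properties using (filter-notAll; length-map)
import Data.List.Relation.Unary.All as All
open import Data.List.Relation.Unary.All.Properties using (¬Any⇒All¬)
open import Data.List.Relation.Unary.AllPairs using ([]; _∷_)
open import Data.List.Relation.Unary.Any as Any using (index; here; there)
open import Data.List.Relation.Unary.Any.Properties using (lookup-index)
open import Data.List.Relation.Unary.Unique.Propositional using (Unique)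
import Data.List.Relation.Unary.Unique.Propositional.Properties as Unique
import Data.List.Relation.Unary.Unique.Setoid as Uniqueₛ
import Data.List.Relation.Unary.Unique.Setoid.Properties as Uniqueₛ
open import Data.Nat as ℕ using (ℕ; zero; suc; _∸_; s≤s; z≤n)
import Data.Nat.Properties as ℕ
open import Data.Product using (∃; ∃-syntax; _×_; _,_; proj₁; proj₂)
open import Data.Product.Properties using (≡-dec)
open import Data.Empty using (⊥)
open import Data.Sum using (_⊎_; inj₁; inj₂; swap)
open import Data.Sum.Properties using (inj₁-injective; inj₂-injective)
import Data.Vec as Vec
import Data.Vec.Functional as Vector
open import Data.Vec.Functional using (removeAt; insertAt)
open import Data.Vec.Functional.Properties using (insertAt-lookup; insertAt-punchIn)
open import Data.Vec.Properties using ([]=⇒lookup; lookup⇒[]=; lookup∘tabulate)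
open import Function using (_∘_; id; case_of_)
open import Function.Definitions using (Injective)
open import Level using (Level; Lift; lift; _⊔_)
open import Relation.Binary using (Rel; DecidableEquality; IsDecTotalOrder; Setoid)
open import Relation.Binary.Construct.Add.Supremum.Strict ℕ._<_ using ([_])
open import Relation.Binary.Construct.Closure.Equivalence as EqClosure using (EqClosure)
open import Relation.Binary.Construct.Closure.ReflexiveTransitive using (Star; ε; _◅_; _◅◅_)
open import Relation.Binary.Construct.Closure.Symmetric using (SymClosure; fwd; bwd)
open import Relation.Binary.PropositionalEquality as ≡ using (_≡_; _≢_)
open import Relation.Nullary using (¬_; yes; no; does; contradiction)
open import Relation.Nullary.Construct.Add.Supremum using ([_]; ⊤⁺)
open import Relation.Nullary.Decidable using (¬?; decidable-stable; dec-true; dec-false)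
open import Relation.Unary using (Pred; Decidable)

module Combinatorics where

  open ≡ using (refl; sym; trans; cong; subst; setoid)
  open import Data.List.Relation.Binary.Subset.Propositional using (_⊆_)
  open import Data.Nat using (_+_; _<_; _≤_)

  private variable
    v r : Level
    V : Set v
    k : ℕ

  -- Lists without repetition and subsets of a finite set.

  module _ {c ℓ} (S : Setoid c ℓ) where
    open Setoid S using (_≈_) renaming (sym to ≈-sym)

    unique⇒lookup-injective : ∀ {xs} → Uniqueₛ.Unique S xs → ∀ i j → lookup xs i ≈ lookup xs j → i ≡ j
    unique⇒lookup-injective (_ ∷ _)      zero    zero    _  = refl
    unique⇒lookup-injective (x∉ ∷ _)     zero    (suc j) eq = contradiction eq (All.lookup x∉ (∈-lookup j))
    unique⇒lookup-injective (x∉ ∷ _)     (suc i) zero    eq = contradiction (≈-sym eq) (All.lookup x∉ (∈-lookup i))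
    unique⇒lookup-injective (_ ∷ unique) (suc i) (suc j) eq =
      cong suc (unique⇒lookup-injective unique i j eq)

  -- Pigeonhole: if every index lay in `xs`, the positions would inject `Fin d` into a shorter list.
  -- This serves to pad the support of a relation to exactly the size that the girth hypothesis
  -- speaks of.
  extend-unique : ∀ {d} (xs : List (Fin d)) → Unique xs → ∀ t → t + length xs ≤ d →
                  ∃[ ys ] (Unique ys × xs ⊆ ys × length ys ≡ t + length xs)
  extend-unique     xs unique zero    _ = xs , unique , (λ x∈ → x∈) , refl
  extend-unique {d} xs unique (suc t) bound =
    let i , i∉xs = fresh
        ys , ys! , ⊆ys , eq = extend-unique (i ∷ xs) (¬Any⇒All¬ xs i∉xs ∷ unique) t
                                (subst (_≤ d) (sym (ℕ.+-suc t _)) bound)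
    in ys , ys! , ⊆ys ∘ there , trans eq (ℕ.+-suc t _)
    where
    open DecMembership (_≟_ {d}) using (_∈?_)
    fresh : ∃[ i ] ¬ (i ∈ xs)
    fresh = ¬∀⟶∃¬ d (_∈ xs) (_∈? xs) λ all∈ → ℕ.<⇒≱ (ℕ.≤-<-trans (ℕ.m≤n+m _ t) bound)
      (injective⇒≤ {f = index ∘ all∈} (λ {i} {j} → ∈ₛ.index-injective (setoid _) (all∈ i) (all∈ j)))

  module _ {k p} {P : Pred (Fin k) p} (P? : Decidable P) where

    comprehension : Subset k
    comprehension = Vec.tabulate (does ∘ P?)

    ∈-comprehension⁺ : ∀ {i} → P i → i ∈ₛ comprehension
    ∈-comprehension⁺ {i} Pi = lookup⇒[]= i comprehension (trans (lookup∘tabulate (does ∘ P?) i) (dec-true (P? i) Pi))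

    ∈-comprehension⁻ : ∀ {i} → i ∈ₛ comprehension → P i
    ∈-comprehension⁻ {i} i∈ = decidable-stable (P? i) λ ¬Pi →
      case trans (sym ([]=⇒lookup i∈)) (trans (lookup∘tabulate (does ∘ P?) i) (dec-false (P? i) ¬Pi)) of λ ()

  ∣p∣+∣∁p∣≡n : ∀ {k} (p : Subset k) → ∣ p ∣ + ∣ ∁ p ∣ ≡ k
  ∣p∣+∣∁p∣≡n {k} p = trans (cong (∣ p ∣ +_) (∣∁p∣≡n∸∣p∣ p)) (ℕ.m+[n∸m]≡n (∣p∣≤n p))

  ∁-isPartition : ∀ {k} (p : Subset k) → IsPartition p (∁ p)
  ∁-isPartition p = record
    { disjoint = λ (_ , i∈) → let i∈p , i∈∁p = x∈p∩q⁻ p (∁ p) i∈ in x∈p⇒x∉∁p i∈p i∈∁p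
    ; covering = p∪∁p≡⊤ p
    }

  0<∣p∣ : ∀ {k} {p : Subset k} {i} → i ∈ₛ p → 0 < ∣ p ∣
  0<∣p∣ i∈p = ℕ.≤-<-trans z≤n (x∈p⇒∣p-x∣<∣p∣ i∈p)

  -- Connected components

  -- `t` counts edges. The layout follows `IsCycle`, so that a closing edge can be added without
  -- reindexing.
  record SimplePath {V : Set v} (R : Rel V r) (p q : V) (t : ℕ) : Set (v ⊔ r) where
    field
      vertex   : Fin (suc t) → V
      distinct : Injective _≡_ _≡_ vertex
      source   : vertex zero ≡ p
      target   : vertex (fromℕ t) ≡ q
      edges    : ∀ i → R (vertex (inject₁ i)) (vertex (suc i))

  open SimplePath public

  module _ {R : Rel V r} where

    suffix : ∀ {p q t} (π : SimplePath R p q t) i → ∃ (SimplePath R (vertex π i) q)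
    suffix {t = t}     π zero    = t , record { SimplePath π; source = refl }
    suffix {t = suc t} π (suc i) = suffix (record
      { vertex   = vertex π ∘ suc
      ; distinct = suc-injective ∘ distinct π
      ; source   = refl
      ; target   = target π
      ; edges    = edges π ∘ suc
      }) i

    module _ (_≟ᵥ_ : DecidableEquality V) where

      -- If `p` already lies on the path, the walk has made a loop, and everything before that visit
      -- is dropped. The new length can stay unspecified because `simplePath-length≤` bounds every
      -- simple path along listed edges.
      prepend : ∀ {p p′ q t} → R p p′ → SimplePath R p′ q t → ∃ (SimplePath R p q)
      prepend {p} {t = t} Rpp′ π with any? (λ i → vertex π i ≟ᵥ p)
      ... | yes (i , refl) = suffix π i
      ... | no p∉ = suc t , record
        { vertex   = p Vector.∷ vertex π
        ; distinct = λ { {zero}  {zero}  _  → refl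
                       ; {zero}  {suc j} eq → contradiction (j , sym eq) p∉
                       ; {suc i} {zero}  eq → contradiction (i , eq) p∉
                       ; {suc i} {suc j} eq → cong suc (distinct π eq) }
        ; source   = refl
        ; target   = target π
        ; edges    = λ { zero    → subst (R p) (sym (source π)) Rpp′
                       ; (suc i) → edges π i }
        }

      loop-erasure : ∀ {p q} → Star R p q → ∃ (SimplePath R p q)
      loop-erasure {p} ε = 0 , record
        { vertex   = λ _ → p
        ; distinct = λ { {zero} {zero} _ → refl }
        ; source   = refl
        ; target   = refl
        ; edges    = λ ()
        }
      loop-erasure (e ◅ es) = prepend e (proj₂ (loop-erasure es))

  Edge : ℕ → Set
  Edge k = Fin k × Fin k

  Linked : List (Edge k) → Rel (Fin k) _
  Linked es p q = (p , q) ∈ es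

  module _ {es : List (Edge k)} where

    edge-index : ∀ {p q} → SymClosure (Linked es) p q → Fin (length es)
    edge-index (fwd e) = index e
    edge-index (bwd e) = index e

    edge-index-injective : ∀ {p q p′ q′} (e : SymClosure (Linked es) p q) (e′ : SymClosure (Linked es) p′ q′) →
                           edge-index e ≡ edge-index e′ → (p ≡ p′ × q ≡ q′) ⊎ (p ≡ q′ × q ≡ p′)
    edge-index-injective (fwd e) (fwd e′) eq with refl ← ∈ₛ.index-injective (setoid _) e e′ eq = inj₁ (refl , refl)
    edge-index-injective (fwd e) (bwd e′) eq with refl ← ∈ₛ.index-injective (setoid _) e e′ eq = inj₂ (refl , refl)
    edge-index-injective (bwd e) (fwd e′) eq with refl ← ∈ₛ.index-injective (setoid _) e e′ eq = inj₂ (refl , refl)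
    edge-index-injective (bwd e) (bwd e′) eq with refl ← ∈ₛ.index-injective (setoid _) e e′ eq = inj₁ (refl , refl)

    -- A simple path uses each listed edge at most once, so its steps inject into the positions of
    -- `es`.
    simplePath-length≤ : ∀ {p q t} → SimplePath (SymClosure (Linked es)) p q t → t ≤ length es
    simplePath-length≤ π = injective⇒≤ {f = edge-index ∘ edges π} λ {i} {j} eq →
      case edge-index-injective (edges π i) (edges π j) eq of λ where
        (inj₁ (eq₁ , _))   → inject₁-injective (distinct π eq₁)
        -- Traversing one edge in opposite directions at steps `i` and `j` would give both
        -- `i = j + 1` and `j = i + 1`.
        (inj₂ (eq₁ , eq₂)) → contradiction
          (trans (cong suc (trans (cong toℕ (sym (distinct π eq₁))) (toℕ-inject₁ i)))
                 (trans (cong toℕ (distinct π eq₂)) (toℕ-inject₁ j)))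
          (ℕ.m+1+n≢n 1)

  -- A partition of the points into `N` nonempty classes, each inside one connected component, so
  -- that `N` bounds the number of components from above. `rep` keeps every class inhabited; any two
  -- labels therefore supply an edge that merges them.
  record Components (es : List (Edge k)) (N : ℕ) : Set where
    field
      label     : Fin k → Fin N
      rep       : Fin N → Fin k
      label-rep : ∀ i → label (rep i) ≡ i
      connected : ∀ {p q} → label p ≡ label q → EqClosure (Linked es) p q

  open Components

  discrete : Components {k} [] k
  discrete = record
    { label     = λ p → p
    ; rep       = λ p → p
    ; label-rep = λ _ → refl
    ; connected = λ { refl → ε }
    }

  module _ {N} {a b : Fin (suc N)} (b≢a : b ≢ a) where

    -- The quotient map that glues `b` to `a`: the value `b` is punched out and sent where `a` goes.
    identify : Fin (suc N) → Fin N
    identify i with b ≟ i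
    ... | yes _  = punchOut b≢a
    ... | no b≢i = punchOut b≢i

    identify-punchIn : ∀ i → identify (punchIn b i) ≡ i
    identify-punchIn i with b ≟ punchIn b i
    ... | yes eq  = contradiction (sym eq) (punchInᵢ≢i b i)
    ... | no b≢pi = trans (punchOut-cong b refl) (punchOut-punchIn b)

    data Identified : Rel (Fin (suc N)) Level.zero where
      same : ∀ {i} → Identified i i
      ab   : Identified a b
      ba   : Identified b a

    identify≡ : ∀ i j → identify i ≡ identify j → Identified i j
    identify≡ i j eq with b ≟ i | b ≟ j
    ... | yes refl | yes refl = same
    ... | yes refl | no b≢j with refl ← punchOut-injective b≢a b≢j eq = ba
    ... | no b≢i | yes refl with refl ← punchOut-injective b≢i b≢a eq = ab
    ... | no b≢i | no b≢j with refl ← punchOut-injective b≢i b≢j eq = same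

  -- A path between the two old classes runs inside one, crosses the new edge and continues inside
  -- the other.
  merge : ∀ {N} {es : List (Edge k)} (C : Components es (suc N)) {p q} → label C q ≢ label C p →
          Components ((p , q) ∷ es) N
  merge {es = es} C {p} {q} q≢p = record
    { label     = identify q≢p ∘ label C
    -- The merged class keeps the representative of the class of `p`; that of the class of `q` is
    -- skipped.
    ; rep       = rep C ∘ punchIn (label C q)
    ; label-rep = λ i → trans (cong (identify q≢p) (label-rep C _)) (identify-punchIn q≢p i)
    ; connected = λ {p′} {q′} eq → connected′ (identify≡ q≢p _ _ eq) refl refl
    }
    where
    old : ∀ {p′ q′} → label C p′ ≡ label C q′ → EqClosure (Linked ((p , q) ∷ es)) p′ q′
    old eq = EqClosure.map there (connected C eq)

    connected′ : ∀ {i j p′ q′} → Identified q≢p i j → label C p′ ≡ i → label C q′ ≡ j →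
                 EqClosure (Linked ((p , q) ∷ es)) p′ q′
    connected′ same eq₁ eq₂ = old (trans eq₁ (sym eq₂))
    connected′ ab   eq₁ eq₂ = old eq₁ ◅◅ fwd (here refl) ◅ old (sym eq₂)
    connected′ ba   eq₁ eq₂ = old eq₁ ◅◅ bwd (here refl) ◅ old (sym eq₂)

  -- Each new edge joins representatives of two different classes and so costs one class. The target
  -- is a successor, which guarantees two labels before each addition.
  add-edges : ∀ t N {es : List (Edge k)} → Components es (t + suc N) →
              ∃[ es′ ] (es ⊆ es′ × length es′ ≡ t + length es × Components es′ (suc N))
  add-edges zero    N C = _ , (λ e → e) , refl , C
  add-edges (suc t) N {es} C =
    let es′ , ⊆es′ , eq , C′ = add-edges t N (merge C (λ eq → case trans (sym (label-rep C first)) (trans (sym eq) (label-rep C second)) of λ ()))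
    in es′ , ⊆es′ ∘ there , trans eq (ℕ.+-suc t _) , C′
    where
    first second : Fin (suc (t + suc N))
    first = zero
    second = suc (subst Fin (sym (ℕ.+-suc t N)) zero)

open Combinatorics

module Geometry {c ℓ₁ ℓ₂ : Level} (ℝ : Reals c ℓ₁ ℓ₂) where

  open Reals ℝ hiding (_≟_)
  open Reals ℝ using () renaming (_≟_ to _≈?_)
  open Euclidean ℝ renaming (_∈_ to _∈ᶠ_; _⊆_ to _⊆ᶠ_)
  open CommutativeRing commutativeRing
    hiding (Carrier; _≈_; _+_; _*_; -_; 0#; 1#; isCommutativeRing; zero)
  open RingProperties ring using (-‿distribʳ-*; -1*x≈-x)
  open AbelianGroupProperties +-abelianGroup using ()
    renaming (x∙y⁻¹≈ε⇒x≈y to x-y≈0⇒x≈y; x≈y⇒x∙y⁻¹≈ε to x≈y⇒x-y≈0; ⁻¹-anti-homo‿- to -[x-y]≈y-x; ∙-cancelʳ to +-cancelʳ)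
  open SemiringSum semiring
  open import Relation.Binary.Reasoning.Setoid setoid

  private variable
    n d m : ℕ

  -- Linear algebra

  *-cancel-≉0 : ∀ {a b} → ¬ (b ≈ 0#) → a * b ≈ 0# → a ≈ 0#
  *-cancel-≉0 {a} {b} b≉0 ab≈0 with b⁻¹ , bb⁻¹≈1 ← inverse b b≉0 = begin
    a               ≈⟨ *-identityʳ a ⟨
    a * 1#          ≈⟨ *-congˡ bb⁻¹≈1 ⟨
    a * (b * b⁻¹)   ≈⟨ *-assoc a b b⁻¹ ⟨
    a * b * b⁻¹     ≈⟨ *-congʳ ab≈0 ⟩
    0# * b⁻¹        ≈⟨ zeroˡ b⁻¹ ⟩
    0#              ∎

  -- The order excludes 2-torsion: if `0 ≤ a` then `a ≤ a + a = 0`, and dually. This separates a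
  -- nonzero difference from its negative.
  x+x≈0⇒x≈0 : ∀ {a} → a + a ≈ 0# → a ≈ 0#
  x+x≈0⇒x≈0 {a} 2a≈0 = case ≤.total 0# a of λ where
      (inj₁ 0≤a) → ≤.antisym (≤.≤-respʳ-≈ 2a≈0 (≤.≤-respˡ-≈ (+-identityʳ a) (+-monoʳ-≤ a 0≤a))) 0≤a
      (inj₂ a≤0) → ≤.antisym a≤0 (≤.≤-respʳ-≈ (+-identityʳ a) (≤.≤-respˡ-≈ 2a≈0 (+-monoʳ-≤ a a≤0)))
    where module ≤ = IsDecTotalOrder isDecTotalOrder

  sum-zero : (f : ℝ^ n) → f ≋ 0ᵥ → sum f ≈ 0#
  sum-zero {n} f f≋0 = trans (sum-cong-≋ f≋0) (sum-replicate-zero n)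

  sum-single : ∀ (f : ℝ^ n) i → (∀ j → j ≢ i → f j ≈ 0#) → sum f ≈ f i
  sum-single {suc n} f i f≈0 = begin
    sum f                     ≈⟨ sum-remove {i = i} f ⟩
    f i + sum (removeAt f i)  ≈⟨ +-congˡ (sum-zero _ λ j → f≈0 (punchIn i j) (punchInᵢ≢i i j)) ⟩
    f i + 0#                  ≈⟨ +-identityʳ (f i) ⟩
    f i                       ∎

  dot : ℝ^ n → ℝ^ n → Carrier
  dot u w = sum λ i → u i * w i

  dot-congˡ : ∀ {u v : ℝ^ n} w → u ≋ v → dot u w ≈ dot v w
  dot-congˡ w u≋v = sum-cong-≋ λ i → *-congʳ (u≋v i)

  dot-congʳ : ∀ (u : ℝ^ n) {v w} → v ≋ w → dot u v ≈ dot u w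
  dot-congʳ u v≋w = sum-cong-≋ λ i → *-congˡ (v≋w i)

  dot-comm : ∀ (u w : ℝ^ n) → dot u w ≈ dot w u
  dot-comm u w = sum-cong-≋ λ i → *-comm (u i) (w i)

  dot-zeroˡ : ∀ {u : ℝ^ n} w → u ≋ 0ᵥ → dot u w ≈ 0#
  dot-zeroˡ w u≋0 = sum-zero _ λ i → trans (*-congʳ (u≋0 i)) (zeroˡ (w i))

  dot-zeroʳ : ∀ (u : ℝ^ n) {w} → w ≋ 0ᵥ → dot u w ≈ 0#
  dot-zeroʳ u w≋0 = trans (dot-comm u _) (dot-zeroˡ u w≋0)

  dot-+ᵥ : ∀ (u v w : ℝ^ n) → dot (u +ᵥ v) w ≈ dot u w + dot v w
  dot-+ᵥ u v w = trans (sum-cong-≋ λ i → distribʳ (w i) (u i) (v i)) (∑-distrib-+ (λ i → u i * w i) (λ i → v i * w i))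

  dot-*ᵥ : ∀ a (v w : ℝ^ n) → dot (a *ᵥ v) w ≈ a * dot v w
  dot-*ᵥ a v w = trans (sum-cong-≋ λ i → *-assoc a (v i) (w i)) (sym (*-distribˡ-sum a (λ i → v i * w i)))

  -ᵥ≋+ᵥ : ∀ (u v : ℝ^ n) → u -ᵥ v ≋ u +ᵥ (- 1#) *ᵥ v
  -ᵥ≋+ᵥ u v i = +-congˡ (sym (-1*x≈-x (v i)))

  dot--ᵥ : ∀ (u v w : ℝ^ n) → dot (u -ᵥ v) w ≈ dot u w + - dot v w
  dot--ᵥ u v w = begin
    dot (u -ᵥ v) w                   ≈⟨ dot-congˡ w (-ᵥ≋+ᵥ u v) ⟩
    dot (u +ᵥ (- 1#) *ᵥ v) w         ≈⟨ dot-+ᵥ u _ w ⟩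
    dot u w + dot ((- 1#) *ᵥ v) w    ≈⟨ +-congˡ (dot-*ᵥ (- 1#) v w) ⟩
    dot u w + - 1# * dot v w         ≈⟨ +-congˡ (-1*x≈-x _) ⟩
    dot u w + - dot v w              ∎

  -- Exchange of two finite sums.
  dot-linearCombination : ∀ (a : ℝ^ m) (B : Fin m → ℝ^ n) w →
    dot (linearCombination a B) w ≈ dot a (λ j → dot (B j) w)
  dot-linearCombination {m} {n} a B w = begin
    sum (λ i → sum (λ j → a j * B j i) * w i)    ≈⟨ sum-cong-≋ (λ i → *-distribʳ-sum (w i) (λ j → a j * B j i)) ⟩
    sum (λ i → sum (λ j → a j * B j i * w i))    ≈⟨ ∑-comm {n} {m} _ ⟩
    sum (λ j → sum (λ i → a j * B j i * w i))    ≈⟨ sum-cong-≋ (λ j → sum-cong-≋ λ i → *-assoc (a j) (B j i) (w i)) ⟩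
    sum (λ j → sum (λ i → a j * (B j i * w i)))  ≈⟨ sum-cong-≋ (λ j → sym (*-distribˡ-sum (a j) (λ i → B j i * w i))) ⟩
    sum (λ j → a j * sum (λ i → B j i * w i))    ∎

  dot-insertAt : ∀ (u : ℝ^ (suc n)) w i a → dot u (insertAt w i a) ≈ u i * a + dot (removeAt u i) w
  dot-insertAt u w i a = trans (sum-remove {i = i} (λ j → u j * insertAt w i a j))
    (+-cong (*-congˡ (reflexive (insertAt-lookup w i a)))
            (sum-cong-≋ λ j → *-congˡ (reflexive (insertAt-punchIn w i a j))))

  ≉0⇒∃≉0 : ∀ (u : ℝ^ n) → ¬ (u ≋ 0ᵥ) → ∃[ i ] ¬ (u i ≈ 0#)
  ≉0⇒∃≉0 u u≉0 with any? (λ i → ¬? (u i ≈? 0#))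
  ... | yes found = found
  ... | no none = contradiction (λ i → decidable-stable (u i ≈? 0#) λ ui≉0 → none (i , ui≉0)) u≉0

  -- Gaussian elimination by induction on the number of equations: each step removes one equation
  -- and one unknown, so the unknowns stay in excess.
  homogeneous-solution : ∀ {r} → r ℕ.< n → (M : Matrix r n) →
                         ∃[ w ] (¬ (w ≋ 0ᵥ) × ∀ i → dot (M i) w ≈ 0#)
  homogeneous-solution {suc n} {zero} _ M = (λ _ → 1#) , (λ 1≋0 → 0≉1 (sym (1≋0 zero))) , λ ()
  homogeneous-solution {suc (suc n)} {suc r} (s≤s r<n) M with any? (λ j → ¬? (M zero j ≈? 0#))
  ... | no row≈0 =
    -- A vanishing first row constrains nothing; the first unknown is fixed at 0 so that an unknown
    -- disappears along with the equation.
    let w , w≉0 , eqs = homogeneous-solution r<n (λ i → removeAt (M (suc i)) zero)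
    in insertAt w zero 0# , (λ w≋0 → w≉0 (w≋0 ∘ suc)) , λ where
      zero    → dot-zeroˡ (insertAt w zero 0#) λ j → decidable-stable (M zero j ≈? 0#) λ ≉0 → row≈0 (j , ≉0)
      (suc i) → trans (+-cong (zeroʳ _) (eqs i)) (+-identityˡ 0#)
  ... | yes (j , pivot≉0) with y , pivot*y≈1 ← inverse _ pivot≉0 =
    let w , w≉0 , eqs = homogeneous-solution r<n reduced
        S = dot (removeAt (M zero) j) w
        -- `b` solves the first equation for the pivot unknown, `y` being the inverse of the pivot.
        b = - (y * S)
    in insertAt w j b
     , (λ w≋0 → w≉0 λ i → trans (reflexive (≡.sym (insertAt-punchIn w j b i))) (w≋0 (punchIn j i)))
     , λ where
      zero → begin
        dot (M zero) (insertAt w j b)   ≈⟨ dot-insertAt (M zero) w j b ⟩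
        M zero j * - (y * S) + S        ≈⟨ +-congʳ (-‿distribʳ-* _ _) ⟨
        - (M zero j * (y * S)) + S      ≈⟨ +-congʳ (-‿cong (*-assoc _ y S)) ⟨
        - (M zero j * y * S) + S        ≈⟨ +-congʳ (-‿cong (trans (*-congʳ pivot*y≈1) (*-identityˡ S))) ⟩
        - S + S                         ≈⟨ -‿inverseˡ S ⟩
        0#                              ∎
      (suc i) → begin
        dot (M (suc i)) (insertAt w j b)                          ≈⟨ dot-insertAt (M (suc i)) w j b ⟩
        M (suc i) j * - (y * S) + dot (removeAt (M (suc i)) j) w  ≈⟨ +-comm _ _ ⟩
        dot (removeAt (M (suc i)) j) w + M (suc i) j * - (y * S)  ≈⟨ +-congˡ (-‿distribʳ-* _ _) ⟨
        dot (removeAt (M (suc i)) j) w + - (M (suc i) j * (y * S)) ≈⟨ +-congˡ (-‿cong (*-assoc _ y S)) ⟨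
        dot (removeAt (M (suc i)) j) w + - (M (suc i) j * y * S)  ≈⟨ +-congˡ (-‿cong (dot-*ᵥ _ (removeAt (M zero) j) w)) ⟨
        dot (removeAt (M (suc i)) j) w + - dot ((M (suc i) j * y) *ᵥ removeAt (M zero) j) w ≈⟨ dot--ᵥ (removeAt (M (suc i)) j) ((M (suc i) j * y) *ᵥ removeAt (M zero) j) w ⟨
        dot (reduced i) w                                         ≈⟨ eqs i ⟩
        0#                                                        ∎
    where
    -- Subtracting this multiple of the first row clears column `j`, which is then omitted.
    reduced : Matrix r (suc n)
    reduced i = removeAt (M (suc i)) j -ᵥ (M (suc i) j * y) *ᵥ removeAt (M zero) j

  δ : Fin n → ℝ^ n
  δ i j with i ≟ j
  ... | yes _ = 1#
  ... | no _  = 0#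

  δ-diag : ∀ (i : Fin n) → δ i i ≈ 1#
  δ-diag i with i ≟ i
  ... | yes _  = refl
  ... | no i≢i = contradiction ≡.refl i≢i

  δ-off : ∀ {i j : Fin n} → i ≢ j → δ i j ≈ 0#
  δ-off {i = i} {j} i≢j with i ≟ j
  ... | yes i≡j = contradiction i≡j i≢j
  ... | no _    = refl

  dot-δ : ∀ (i : Fin n) u → dot (δ i) u ≈ u i
  dot-δ i u = begin
    dot (δ i) u   ≈⟨ sum-single _ i (λ j j≢i → trans (*-congʳ (δ-off (j≢i ∘ ≡.sym))) (zeroˡ (u j))) ⟩
    δ i i * u i   ≈⟨ *-congʳ (δ-diag i) ⟩
    1# * u i      ≈⟨ *-identityˡ (u i) ⟩
    u i           ∎

  -- Hyperplanes as kernels of nonzero functionals.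

  Kernel : ℝ^ n → ℝ^ n → Set (c ⊔ ℓ₁)
  Kernel w v = Lift c (dot v w ≈ 0#)

  Kernel-isLinearSubspace : ∀ (w : ℝ^ n) → IsLinearSubspace (Kernel w)
  Kernel-isLinearSubspace w = record
    { resp     = λ { u≋v (lift u∈) → lift (trans (dot-congˡ w (sym ∘ u≋v)) u∈) }
    ; 0-closed = lift (dot-zeroˡ w λ _ → refl)
    ; +-closed = λ { {u} {v} (lift u∈) (lift v∈) → lift (trans (dot-+ᵥ u v w) (trans (+-cong u∈ v∈) (+-identityˡ 0#))) }
    ; *-closed = λ { a {v} (lift v∈) → lift (trans (dot-*ᵥ a v w) (trans (*-congˡ v∈) (zeroʳ a))) }
    }

  module KernelBasis (w : ℝ^ (suc n)) (k : Fin (suc n)) (wₖ≉0 : ¬ (w k ≈ 0#)) where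

    private
      wₖ⁻¹ : Carrier
      wₖ⁻¹ = proj₁ (inverse (w k) wₖ≉0)

    -- The coordinates off `k` are free, and the `k`-th is solved for, `w k` being invertible.
    basis : Fin n → ℝ^ (suc n)
    basis i = insertAt (δ i) k (- (wₖ⁻¹ * w (punchIn k i)))

    basis-member : ∀ i → dot (basis i) w ≈ 0#
    basis-member i = begin
      dot (basis i) w                              ≈⟨ dot-comm (basis i) w ⟩
      dot w (basis i)                              ≈⟨ dot-insertAt w (δ i) k _ ⟩
      w k * - (wₖ⁻¹ * wᵢ) + dot (removeAt w k) (δ i) ≈⟨ +-cong (sym (-‿distribʳ-* _ _)) (trans (dot-comm (removeAt w k) _) (dot-δ i _)) ⟩
      - (w k * (wₖ⁻¹ * wᵢ)) + wᵢ                   ≈⟨ +-congʳ (-‿cong (*-assoc _ _ _)) ⟨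
      - (w k * wₖ⁻¹ * wᵢ) + wᵢ                     ≈⟨ +-congʳ (-‿cong (trans (*-congʳ (proj₂ (inverse (w k) wₖ≉0))) (*-identityˡ wᵢ))) ⟩
      - wᵢ + wᵢ                                    ≈⟨ -‿inverseˡ wᵢ ⟩
      0#                                           ∎
      where wᵢ = w (punchIn k i)

    -- Off `k` the basis vectors are standard unit vectors, so coefficients can be read off there;
    -- independence follows at once.
    linearCombination-punchIn : ∀ a i → linearCombination a basis (punchIn k i) ≈ a i
    linearCombination-punchIn a i = begin
      dot a (λ j → basis j (punchIn k i))  ≈⟨ dot-congʳ a (λ j → reflexive (insertAt-punchIn (δ j) k _ i)) ⟩
      dot a (λ j → δ j i)                  ≈⟨ sum-single _ i (λ j j≢i → trans (*-congˡ (δ-off j≢i)) (zeroʳ (a j))) ⟩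
      a i * δ i i                          ≈⟨ *-congˡ (δ-diag i) ⟩
      a i * 1#                             ≈⟨ *-identityʳ (a i) ⟩
      a i                                  ∎

    ≈0-off-k : ∀ u → dot u w ≈ 0# → (∀ i → u (punchIn k i) ≈ 0#) → u ≋ 0ᵥ
    ≈0-off-k u u∈ u≈0 j with k ≟ j
    ... | no k≢j = trans (reflexive (≡.cong u (≡.sym (punchIn-punchOut k≢j)))) (u≈0 _)
    ... | yes ≡.refl = *-cancel-≉0 wₖ≉0 (begin
      u k * w k                                       ≈⟨ +-identityʳ _ ⟨
      u k * w k + 0#                                  ≈⟨ +-congˡ (dot-zeroˡ (removeAt w k) u≈0) ⟨
      u k * w k + dot (removeAt u k) (removeAt w k)   ≈⟨ sum-remove {i = k} (λ i → u i * w i) ⟨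
      dot u w                                         ≈⟨ u∈ ⟩
      0#                                              ∎)

    isBasis : IsBasis (Kernel w) basis
    isBasis = record
      { members     = λ i → lift (basis-member i)
      ; independent = λ a a≋0 i → trans (sym (linearCombination-punchIn a i)) (a≋0 (punchIn k i))
      -- The coefficients must be the coordinates of `v` off `k`. The combination then differs from
      -- `v` by a kernel vector that vanishes off `k`, hence by zero.
      ; spanning    = λ { v (lift v∈) → removeAt v k , λ j → x-y≈0⇒x≈y _ _ (≈0-off-k
          (linearCombination (removeAt v k) basis -ᵥ v)
          (trans (dot--ᵥ (linearCombination (removeAt v k) basis) v w) (x≈y⇒x-y≈0 (trans
            (trans (dot-linearCombination (removeAt v k) basis w) (dot-zeroʳ (removeAt v k) basis-member)) (sym v∈))))
          (λ i → x≈y⇒x-y≈0 (linearCombination-punchIn (removeAt v k) i))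
          j) }
      }

  -- A nonzero coordinate exists only for `n ≥ 1`, so `n ∸ 1` is not truncated here.
  Kernel-dimension : (w : ℝ^ n) → ∃[ k ] ¬ (w k ≈ 0#) → HasDimension (Kernel w) (n ∸ 1)
  Kernel-dimension {suc n} w (k , wₖ≉0) = _ , KernelBasis.isBasis w k wₖ≉0

  module _ (w : ℝ^ n) (w≉0 : ¬ (w ≋ 0ᵥ)) where

    level-set : ℝ^ n → Hyperplane n
    level-set p = record
      { point            = p
      ; direction        = Kernel w
      ; isLinearSubspace = Kernel-isLinearSubspace w
      ; dimension        = Kernel-dimension w (≉0⇒∃≉0 w w≉0)
      }

  -- Columns as differences of pairs of points.

  diff : ∀ {k} → (Fin k → ℝ^ n) → Edge k → ℝ^ n
  diff x (p , q) = x p -ᵥ x q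

  column : (D : FiniteSet n) → Fin (card D) → ℝ^ n
  column D = lookup (elements D)

  column-injective : ∀ (D : FiniteSet n) {i j} → column D i ≋ column D j → i ≡ j
  column-injective {n} D = unique⇒lookup-injective (ℝ^-setoid n) (unique D) _ _

  module _ {k} (x : Fin k → ℝ^ n) (I J : Subset k) where

    ∈-𝒟⁺ : ∀ {p q} → p ∈ₛ I → q ∈ₛ J → (x p -ᵥ x q) ∈ᶠ 𝒟 x I J
    ∈-𝒟⁺ p∈I q∈J = ∈ₛ.∈-deduplicate⁺ (ℝ^-setoid n) _ (λ z≋y x≋y i → trans (x≋y i) (sym (z≋y i)))
      (∈ₛ.∈-cartesianProductWith⁺ (ℝ^-setoid n) (ℝ^-setoid n) (ℝ^-setoid n)
        (λ u≋u′ v≋v′ i → +-cong (u≋u′ i) (-‿cong (v≋v′ i)))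
        (∈-points p∈I) (∈-points q∈J))
      where
      ∈-points : ∀ {T p} → p ∈ₛ T → Any.Any (x p ≋_) (map x (filter (_∈ₛ? T) (allFin k)))
      ∈-points {T} {p} p∈T = ∈ₛ.∈-map∘filter⁺ (≡.setoid _) (ℝ^-setoid n) (_∈ₛ? T) (≡.subst (_∈ₛ T))
        (λ { ≡.refl i → refl }) (p , ∈-allFin p , (λ i → refl) , p∈T)

    -- Several pairs may share one difference; some realising pair is returned, and it becomes the
    -- edge of that column.
    ∈-𝒟⁻ : ∀ {v} → v ∈ᶠ 𝒟 x I J → ∃[ p ] ∃[ q ] (p ∈ₛ I × q ∈ₛ J × v ≋ x p -ᵥ x q)
    ∈-𝒟⁻ v∈𝒟 =
      let _ , _ , u∈ , w∈ , v≋u-w = ∈ₛ.∈-cartesianProductWith⁻ (ℝ^-setoid n) (ℝ^-setoid n) (ℝ^-setoid n) _-ᵥ_ _ _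
                                      (∈ₛ.∈-deduplicate⁻ (ℝ^-setoid n) _ _ v∈𝒟)
          p , u≋xp , p∈I = ∈-points⁻ u∈
          q , w≋xq , q∈J = ∈-points⁻ w∈
      in p , q , p∈I , q∈J , λ i → trans (v≋u-w i) (+-cong (u≋xp i) (-‿cong (w≋xq i)))
      where
      ∈-points⁻ : ∀ {T v} → Any.Any (v ≋_) (map x (filter (_∈ₛ? T) (allFin k))) → ∃[ p ] (v ≋ x p × p ∈ₛ T)
      ∈-points⁻ {T} v∈ =
        let p , _ , v≋xp , p∈T = ∈ₛ.∈-map∘filter⁻ (≡.setoid _) (ℝ^-setoid n) (_∈ₛ? T) (≡.subst (_∈ₛ T)) {xs = allFin k} v∈
        in p , v≋xp , p∈T

  -- Covers obtained from linear relations between the columns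

  module _ {k} (x : Fin k → ℝ^ n) (D : FiniteSet n) (e : Fin (card D) → Edge k)
           (column≋diff : ∀ j → column D j ≋ diff x (e j)) where

    module _ (I J : Subset k) (disjoint : Empty (I ∩ J))
             (tail∈I : ∀ j → proj₁ (e j) ∈ₛ I) (head∈J : ∀ j → proj₂ (e j) ∈ₛ J)
             (D′ : FiniteSet n) (s : ℕ)
             (no-short-cycle : ∀ q → HasCycleOfLength (Γ x I J D′) q → s ℕ.< q) where

      open Graph (Γ x I J D′) using (Adj)

      ∈I×∈J⇒≢ : ∀ {p} → p ∈ₛ I → p ∈ₛ J → ∀ {a} {X : Set a} → X
      ∈I×∈J⇒≢ p∈I p∈J = contradiction (_ , x∈p∩q⁺ (p∈I , p∈J)) disjoint

      module _ (js : List (Fin (card D))) (js⊆D′ : ∀ {j} → j ∈ js → column D j ∈ᶠ D′) where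

        adjacent : ∀ {p q} → SymClosure (Linked (map e js)) p q → Adj p q
        adjacent = λ where
            (fwd pq∈) → inj₁ (appears pq∈)
            (bwd qp∈) → inj₂ (appears qp∈)
          where
          appears : ∀ {p q} → (p , q) ∈ map e js → p ∈ₛ I × q ∈ₛ J × (x p -ᵥ x q) ∈ᶠ D′
          appears pq∈ with j , j∈js , ≡.refl ← ∈-map⁻ e pq∈ =
            tail∈I j , head∈J j , ∈ₛ.∈-resp-≈ (ℝ^-setoid n) (column≋diff j) (js⊆D′ j∈js)

        -- A repeated edge would be a repeated column, and a reversed one would put a point in both
        -- `I` and `J`.
        ¬linked : ∀ {i} → ¬ (i ∈ js) → ¬ SymClosure (Linked (map e js)) (proj₁ (e i)) (proj₂ (e i))
        ¬linked {i} i∉js (fwd ei∈) =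
          let j , j∈js , ei≡ej = ∈-map⁻ e ei∈
          in i∉js (≡.subst (_∈ js) (column-injective D λ t →
               trans (column≋diff j t) (trans (reflexive (≡.cong (λ f → diff x f t) (≡.sym ei≡ej))) (sym (column≋diff i t)))) j∈js)
        ¬linked {i} i∉js (bwd ie∈) =
          let j , j∈js , ie≡ej = ∈-map⁻ e ie∈
          in ∈I×∈J⇒≢ (tail∈I i) (≡.subst (_∈ₛ J) (≡.sym (≡.cong proj₂ ie≡ej)) (head∈J j))

        -- The edge `e i` closes the path. Length 0 would give a loop, impossible since `I` and `J`
        -- are disjoint, and length 1 a double edge, excluded by `¬linked`; what remains has at
        -- least three vertices.
        cycle : ∀ {i t} → ¬ (i ∈ js) → column D i ∈ᶠ D′ →
                SimplePath (SymClosure (Linked (map e js))) (proj₁ (e i)) (proj₂ (e i)) t →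
                HasCycleOfLength (Γ x I J D′) (suc t)
        cycle {i} {zero} i∉js i∈D′ π =
          ∈I×∈J⇒≢ (tail∈I i) (≡.subst (_∈ₛ J) (≡.trans (≡.sym (target π)) (source π)) (head∈J i))
        cycle {i} {suc zero} i∉js i∈D′ π =
          contradiction (≡.subst₂ (SymClosure (Linked (map e js))) (source π) (target π) (edges π zero)) (¬linked i∉js)
        cycle {i} {suc (suc t)} i∉js i∈D′ π = suc (suc t) , ≡.refl , vertex π , record
          { 3≤length = s≤s (s≤s (s≤s z≤n))
          ; distinct = distinct π
          ; vertices = λ { zero    → _ , swap closing
                         ; (suc v) → _ , swap (adjacent (edges π v)) }
          ; edges    = adjacent ∘ edges π
          ; closing  = closing
          }
          where
          closing : Adj (vertex π (fromℕ (suc (suc t)))) (vertex π zero)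
          closing = ≡.subst₂ Adj (≡.sym (target π)) (≡.sym (source π))
            (inj₂ (tail∈I i , head∈J i , ∈ₛ.∈-resp-≈ (ℝ^-setoid n) (column≋diff i) i∈D′))

      -- Edges enter one at a time, and each must join two different classes: otherwise it would
      -- close a path of earlier edges into a cycle of length at most `s` in the graph of `D′`. So
      -- every edge costs exactly one class.
      forest : ∀ js → Unique js → length js ℕ.≤ s → (∀ {j} → j ∈ js → column D j ∈ᶠ D′) →
               ∃[ N ] (Components (map e js) N × N ℕ.+ length js ≡ k)
      forest [] _ _ _ = k , discrete , ℕ.+-identityʳ k
      forest (i ∷ js) (i∉js ∷ js!) |js|<s js⊆D′ with forest js js! (ℕ.<⇒≤ |js|<s) (js⊆D′ ∘ there)
      -- A point has a label, so there is at least one class.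
      ... | zero , C , _ = contradiction (Components.label C (proj₁ (e i))) λ ()
      ... | suc N , C , eq with Components.label C (proj₂ (e i)) ≟ Components.label C (proj₁ (e i))
      ...   | no q≢p = N , merge C q≢p , ≡.trans (ℕ.+-suc N _) eq
      ...   | yes q≡p =
        let t , π = loop-erasure _≟_ (Components.connected C (≡.sym q≡p))
            -- Strictness leaves room for the closing edge: the cycle has length `suc t ≤ s`.
            t<s = ℕ.≤-<-trans (ℕ.≤-trans (simplePath-length≤ π) (ℕ.≤-reflexive (length-map e js))) |js|<s
        in contradiction t<s (ℕ.≤⇒≯ (ℕ.≤-pred (no-short-cycle _
             (cycle js (js⊆D′ ∘ there) (λ i∈js → All.lookup i∉js i∈js ≡.refl) (js⊆D′ (here ≡.refl)) π))))

    -- Only n - 1 of the n edges are imposed on w: the relation a makes w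
    -- vanish on the column j₀ once it vanishes on the rest of the support.
    dependent⇒covered : ∀ {N es} (a : ℝ^ (card D)) → A D · a ≋ 0ᵥ → ¬ (a ≋ 0ᵥ) →
                        (∀ j → ¬ (a j ≈ 0#) → e j ∈ es) →
                        length es ≡ n → Components es N → CoveredByParallelHyperplanes x N
    dependent⇒covered {N} {es} a Aa≋0 a≉0 support⊆es |es|≡n C =
        (λ i → level-set w w≉0 (x (rep i)))
      , (λ i j → id , id)
      , (λ p → label p , lift (begin
          dot (x p -ᵥ x (rep (label p))) w             ≈⟨ dot--ᵥ (x p) _ w ⟩
          dot (x p) w + - dot (x (rep (label p))) w    ≈⟨ x≈y⇒x-y≈0 (dot-constant (connected (≡.sym (label-rep (label p))))) ⟩
          0#                                           ∎))
      where
      open Components C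

      j₀ : Fin (card D)
      j₀ = proj₁ (≉0⇒∃≉0 a a≉0)

      aj₀≉0 : ¬ (a j₀ ≈ 0#)
      aj₀≉0 = proj₂ (≉0⇒∃≉0 a a≉0)

      _≟ₑ_ : DecidableEquality (Edge k)
      _≟ₑ_ = ≡-dec _≟_ _≟_

      others : List (Edge k)
      others = filter (λ f → ¬? (f ≟ₑ e j₀)) es

      |others|<n : length others ℕ.< n
      |others|<n = ≡.subst (length others ℕ.<_) |es|≡n (filter-notAll _ es
        (Any.map (λ ej₀≡f f≢ej₀ → f≢ej₀ (≡.sym ej₀≡f)) (support⊆es j₀ aj₀≉0)))

      solution : ∃[ w ] (¬ (w ≋ 0ᵥ) × ∀ i → dot (diff x (lookup others i)) w ≈ 0#)
      solution = homogeneous-solution |others|<n (diff x ∘ lookup others)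

      w : ℝ^ n
      w = proj₁ solution

      w≉0 : ¬ (w ≋ 0ᵥ)
      w≉0 = proj₁ (proj₂ solution)

      w⊥others : ∀ {f} → f ∈ es → f ≢ e j₀ → dot (diff x f) w ≈ 0#
      w⊥others f∈es f≢ej₀ =
        let f∈others = ∈-filter⁺ (λ f → ¬? (f ≟ₑ e j₀)) f∈es f≢ej₀
        in ≡.subst (λ f → dot (diff x f) w ≈ 0#) (≡.sym (lookup-index f∈others)) (proj₂ (proj₂ solution) (index f∈others))

      term≈0 : ∀ j → j ≢ j₀ → a j * dot (column D j) w ≈ 0#
      term≈0 j j≢j₀ with a j ≈? 0#
      ... | yes aj≈0 = trans (*-congʳ aj≈0) (zeroˡ _)
      -- Distinct columns have distinct edges, so `e j` is among those on which `w` was made to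
      -- vanish.
      ... | no aj≉0  = trans (*-congˡ (trans (dot-congˡ w (column≋diff j)) (w⊥others (support⊆es j aj≉0)
        λ ej≡ej₀ → j≢j₀ (column-injective D λ t → trans (column≋diff j t)
          (trans (reflexive (≡.cong (λ f → diff x f t) ej≡ej₀)) (sym (column≋diff j₀ t))))))) (zeroʳ _)

      w⊥ej₀ : dot (diff x (e j₀)) w ≈ 0#
      -- Paired with `w`, the relation between the columns loses every term except the one at `j₀`.
      w⊥ej₀ = trans (dot-congˡ w (sym ∘ column≋diff j₀)) (*-cancel-≉0 aj₀≉0 (begin
        dot (column D j₀) w * a j₀                ≈⟨ *-comm _ _ ⟩
        a j₀ * dot (column D j₀) w                ≈⟨ sum-single (λ j → a j * dot (column D j) w) j₀ term≈0 ⟨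
        dot a (λ j → dot (column D j) w)          ≈⟨ dot-linearCombination a (column D) w ⟨
        dot (linearCombination a (column D)) w    ≈⟨ dot-congˡ w (λ i → dot-comm a (λ j → column D j i)) ⟩
        dot (A D · a) w                           ≈⟨ dot-zeroˡ w Aa≋0 ⟩
        0#                                        ∎))

      dot-constant : ∀ {p q} → EqClosure (Linked es) p q → dot (x p) w ≈ dot (x q) w
      dot-constant = EqClosure.gfold isEquivalence (λ p → dot (x p) w) λ {p} {q} pq∈es →
        x-y≈0⇒x≈y _ _ (trans (sym (dot--ᵥ (x p) (x q) w)) (case (p , q) ≟ₑ e j₀ of λ where
          (yes ≡.refl) → w⊥ej₀
          (no pq≢ej₀)  → w⊥others pq∈es pq≢ej₀))

  girthExceeds⇒< : ∀ {v a} {V : Set v} {G : Graph V a} {s q} → GirthExceeds G s → HasCycleOfLength G q → s ℕ.< q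
  girthExceeds⇒< (_ , (_ , minimal) , [ s<g ]) cycle = ℕ.<-≤-trans s<g (minimal _ cycle)
  girthExceeds⇒< (⊤⁺ , acyclic , _)            cycle = contradiction cycle (acyclic _)

  -- Sensing from large girth and the lack of small covers.

  module _ {k} (n<k : n ℕ.< k) (x : Fin k → ℝ^ n) (I J : Subset k) (I⊔J : IsPartition I J)
           (D : FiniteSet n) (D⊆𝒟 : D ⊆ᶠ 𝒟 x I J) (s : ℕ) (s≤n-1 : s ℕ.≤ n ∸ 1)
           (not-covered : NotCoveredByFewerThan x (k ∸ n ℕ.+ 1))
           (girth : (D′ : FiniteSet n) → D′ ⊆ᶠ D → card D′ ≡ s → GirthExceeds (Γ x I J D′) s)
           (girth-small : card D ℕ.< s → GirthExceeds (Γ x I J D) s) where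

    private
      realisation : ∀ j → ∃[ p ] ∃[ q ] (p ∈ₛ I × q ∈ₛ J × column D j ≋ x p -ᵥ x q)
      realisation j = ∈-𝒟⁻ x I J (D⊆𝒟 (∈ₛ.∈-lookup (ℝ^-setoid n) (elements D) j))

      e : Fin (card D) → Edge k
      e j = let p , q , _ = realisation j in p , q

    -- The girth hypothesis concerns subsets of exactly `s` columns, whereas a support may be
    -- smaller. It is padded to size `s`; if `D` has too few columns for that, `D` itself is taken.
    high-girth-superset : ∀ js → Unique js → length js ℕ.≤ s →
                          ∃[ D′ ] ((∀ {j} → j ∈ js → column D j ∈ᶠ D′) × GirthExceeds (Γ x I J D′) s)
    high-girth-superset js js! |js|≤s with card D ℕ.<? s
    ... | yes |D|<s = D , (λ {j} _ → ∈ₛ.∈-lookup (ℝ^-setoid n) (elements D) j) , girth-small |D|<s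
    ... | no |D|≮s =
      let t+|js|≡s = ℕ.m∸n+n≡m |js|≤s
          is , is! , js⊆is , |is|≡ = extend-unique js js! (s ∸ length js)
                                       (≡.subst (ℕ._≤ card D) (≡.sym t+|js|≡s) (ℕ.≮⇒≥ |D|≮s))
          D′ = record
            { elements = map (column D) is
            ; unique   = Uniqueₛ.map⁺ (≡.setoid _) (ℝ^-setoid n) (column-injective D) is!
            }
      in D′
       , (λ j∈js → ∈ₛ.∈-map⁺ (≡.setoid _) (ℝ^-setoid n) (λ { ≡.refl i → refl }) (js⊆is j∈js))
       , girth D′
           (λ v∈D′ → let i , _ , v≋ = ∈ₛ.∈-map⁻ (≡.setoid _) (ℝ^-setoid n) v∈D′
                     in ∈ₛ.∈-resp-≈ (ℝ^-setoid n) (sym ∘ v≋) (∈ₛ.∈-lookup (ℝ^-setoid n) (elements D) i))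
           (≡.trans (length-map (column D) is) (≡.trans |is|≡ t+|js|≡s))

    sensing : IsSensing s (A D)
    sensing a a≉0 sparse Aa≋0 =
      let D′ , support⊆D′ , girth′ = high-girth-superset support support! sparse
          N , C , N+|support|≡k = forest x D e column≋diff I J (IsPartition.disjoint I⊔J)
            (λ j → proj₁ (proj₂ (proj₂ (realisation j)))) (λ j → proj₁ (proj₂ (proj₂ (proj₂ (realisation j)))))
            D′ s (λ q → girthExceeds⇒< girth′) support support! sparse support⊆D′
          -- The forest has `k - length support` classes; `n - length support` further edges make
          -- `n` edges and `k - n` classes.
          es , ⊆es , |es|≡ , C′ = add-edges (n ∸ length support) o
            (≡.subst (Components (map e support)) (ℕ.+-cancelʳ-≡ (length support) _ _ (≡.trans N+|support|≡k (≡.sym k≡))) C)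
      in not-covered (suc o) (≡.subst (suc o ℕ.<_) (≡.trans (ℕ.+-comm 1 _) (≡.cong (ℕ._+ 1) (≡.sym k-n≡))) (ℕ.n<1+n _))
           (dependent⇒covered x D e column≋diff a Aa≋0 a≉0
             (λ j aj≉0 → ⊆es (∈-map⁺ e (∈-filter⁺ (λ j → ¬? (a j ≈? 0#)) (∈-allFin j) aj≉0)))
             (≡.trans |es|≡ (≡.trans (≡.cong (n ∸ length support ℕ.+_) (length-map e support)) (ℕ.m∸n+n≡m |support|≤n))) C′)
      where
      support : List (Fin (card D))
      support = filter (λ j → ¬? (a j ≈? 0#)) (allFin (card D))

      support! : Unique support
      support! = Unique.filter⁺ (λ j → ¬? (a j ≈? 0#)) (Unique.allFin⁺ (card D))

      |support|≤n : length support ℕ.≤ n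
      |support|≤n = ℕ.≤-trans sparse (ℕ.≤-trans s≤n-1 (ℕ.m∸n≤m n 1))

      o : ℕ
      -- `suc o` is `k - n`, positive as `n < k`; the successor form is what `add-edges` expects.
      o = k ∸ suc n

      n+1+o≡k : n ℕ.+ suc o ≡ k
      n+1+o≡k = ≡.trans (ℕ.+-suc n o) (ℕ.m+[n∸m]≡n n<k)

      k-n≡ : k ∸ n ≡ suc o
      k-n≡ = ≡.trans (≡.cong (_∸ n) (≡.sym n+1+o≡k)) (ℕ.m+n∸m≡n n (suc o))

      k≡ : n ∸ length support ℕ.+ suc o ℕ.+ length support ≡ k
      k≡ = ≡.trans (ℕ.+-assoc (n ∸ length support) (suc o) _)
          (≡.trans (≡.cong (n ∸ length support ℕ.+_) (ℕ.+-comm (suc o) _))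
          (≡.trans (≡.sym (ℕ.+-assoc (n ∸ length support) _ (suc o)))
          (≡.trans (≡.cong (ℕ._+ suc o) (ℕ.m∸n+n≡m |support|≤n)) n+1+o≡k)))

      column≋diff : ∀ j → column D j ≋ diff x (e j)
      column≋diff j = proj₂ (proj₂ (proj₂ (proj₂ (realisation j))))

  -- Linear relations obtained from covers

  -- The coefficients are spread out to a vector `y` on all columns. Injectivity of `g` makes `y`
  -- equal to `v` along `g`, and `y` vanishes off the image of `g`, so it is nonzero and `s`-sparse.
  sensing⇒no-relation : ∀ {s t} {M : Matrix n d} → IsSensing t M → s ℕ.≤ t →
                        (g : Fin s → Fin d) → Injective _≡_ _≡_ g →
                        (v : ℝ^ s) → ¬ (v ≋ 0ᵥ) → ¬ (linearCombination v (λ i r → M r (g i)) ≋ 0ᵥ)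
  sensing⇒no-relation {d = d} {s} {M = M} sensing s≤t g g-injective v v≉0 relation =
    sensing y (λ y≋0 → v≉0 λ i → trans (sym (y∘g≋v i)) (y≋0 (g i))) (ℕ.≤-trans sparse s≤t) λ r → begin
      dot (M r) y                        ≈⟨ dot-comm (M r) y ⟩
      dot y (M r)                        ≈⟨ dot-linearCombination v (δ ∘ g) (M r) ⟩
      dot v (λ i → dot (δ (g i)) (M r))  ≈⟨ dot-congʳ v (λ i → dot-δ (g i) (M r)) ⟩
      dot v (λ i → M r (g i))            ≈⟨ relation r ⟩
      0#                                 ∎
    where
    y : ℝ^ d
    y = linearCombination v (δ ∘ g)

    y∘g≋v : ∀ i → y (g i) ≈ v i
    y∘g≋v i = begin
      dot v (λ j → δ (g j) (g i))  ≈⟨ sum-single (λ j → v j * δ (g j) (g i)) i (λ j j≢i → trans (*-congˡ (δ-off (j≢i ∘ g-injective))) (zeroʳ _)) ⟩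
      v i * δ (g i) (g i)          ≈⟨ *-congˡ (δ-diag (g i)) ⟩
      v i * 1#                     ≈⟨ *-identityʳ (v i) ⟩
      v i                          ∎

    preimage : ∀ {j} → ¬ (y j ≈ 0#) → ∃[ i ] g i ≡ j
    preimage {j} yj≉0 with any? (λ i → g i ≟ j)
    ... | yes found = found
    ... | no none   = contradiction (dot-zeroʳ v λ i → δ-off λ gi≡j → none (i , gi≡j)) yj≉0

    nonzero? : Decidable (λ j → ¬ (y j ≈ 0#))
    nonzero? j = ¬? (y j ≈? 0#)

    support : List (Fin d)
    support = filter nonzero? (allFin d)

    preimage-lookup : ∀ i → ∃[ j ] g j ≡ lookup support i
    preimage-lookup i = preimage (proj₂ (∈-filter⁻ nonzero? {xs = allFin d} (∈-lookup i)))

    sparse : nonzeroCoordinates y ℕ.≤ s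
    -- Preimages under `g` of distinct support indices are distinct, so the support injects into
    -- `Fin s`.
    sparse = injective⇒≤ {f = proj₁ ∘ preimage-lookup} λ {i} {j} eq →
      unique⇒lookup-injective (≡.setoid _) (Unique.filter⁺ nonzero? (Unique.allFin⁺ d)) i j
        (≡.trans (≡.sym (proj₂ (preimage-lookup i))) (≡.trans (≡.cong g eq) (proj₂ (preimage-lookup j))))

  -- In coordinates with respect to the basis, a relation is a solution of `m` homogeneous equations
  -- in `s > m` unknowns.
  subspace-relation : ∀ {s} {W : ℝ^ n → Set (c ⊔ ℓ₁)} → HasDimension W m → m ℕ.< s →
                      (u : Fin s → ℝ^ n) → (∀ i → W (u i)) →
                      ∃[ v ] (¬ (v ≋ 0ᵥ) × linearCombination v u ≋ 0ᵥ)
  subspace-relation {m = m} {s} (b , isBasis) m<s u u∈W =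
    let v , v≉0 , eqs = homogeneous-solution m<s (λ j i → coordinates i j)
    in v , v≉0 , λ r → begin
      dot v (λ i → u i r)                                ≈⟨ dot-congʳ v (λ i → proj₂ (spanning (u i) (u∈W i)) r) ⟨
      dot v (λ i → dot (coordinates i) (λ j → b j r))    ≈⟨ dot-linearCombination v coordinates (λ j → b j r) ⟨
      dot (linearCombination v coordinates) (λ j → b j r) ≈⟨ dot-zeroˡ _ (λ j → trans (dot-comm v _) (eqs j)) ⟩
      0#                                                 ∎
    where
    open IsBasis isBasis
    coordinates : Fin s → ℝ^ m
    coordinates i = proj₁ (spanning (u i) (u∈W i))

  -- Lack of small covers from sensing.

  module _ {k} (x : Fin k → ℝ^ n) (x-injective : Injective _≡_ _≋_ x) (2≤n : 2 ℕ.≤ n)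
           (sensing : ∀ I {p q} → p ∈ₛ I → q ∉ₛ I → IsSensing n (A (𝒟 x I (∁ I)))) where

    -- A nonzero `v` has an index, whose edge shows that `I` and its complement are both inhabited,
    -- as `sensing` demands. Distinct differences select distinct columns.
    no-relation : ∀ {s} I → s ℕ.≤ n → (f : Fin s → Edge k) →
                  (∀ i → proj₁ (f i) ∈ₛ I) → (∀ i → proj₂ (f i) ∉ₛ I) →
                  (∀ i j → diff x (f i) ≋ diff x (f j) → i ≡ j) →
                  ∀ v → ¬ (v ≋ 0ᵥ) → ¬ (linearCombination v (diff x ∘ f) ≋ 0ᵥ)
    no-relation I s≤n f tail∈I head∉I distinct v v≉0 relation =
      sensing⇒no-relation (sensing I (tail∈I (proj₁ (≉0⇒∃≉0 v v≉0))) (head∉I (proj₁ (≉0⇒∃≉0 v v≉0)))) s≤n g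
        (λ {i} {j} gi≡gj → distinct i j λ r → trans (diff≋column i r)
          (trans (reflexive (≡.cong (λ h → column (𝒟 x I (∁ I)) h r) gi≡gj)) (sym (diff≋column j r))))
        v v≉0 (λ r → trans (dot-congʳ v (λ i → sym (diff≋column i r))) (relation r))
      where
      member : ∀ i → diff x (f i) ∈ᶠ 𝒟 x I (∁ I)
      member i = ∈-𝒟⁺ x I (∁ I) (tail∈I i) (x∉p⇒x∈∁p (head∉I i))
      g = λ i → index (member i)
      diff≋column : ∀ i → diff x (f i) ≋ column (𝒟 x I (∁ I)) (g i)
      diff≋column i = lookup-index (member i)

    -- If two disjoint pairs had the same difference u, splitting them in
    -- opposite ways would make both u and - u columns.
    differences-distinct : ∀ {p p′ q q′} → p ≢ p′ → p ≢ q → q ≢ q′ → ¬ (x p -ᵥ x p′ ≋ x q -ᵥ x q′)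
    differences-distinct {p} {p′} {q} {q′} p≢p′ p≢q q≢q′ u≋u′ =
      -- The edges `(p , p′)` and `(q′ , q)` leave this set and have differences `u` and `- u`, so
      -- coefficients 1 and 1 give a relation.
      no-relation (⁅ p ⁆ ∪ ⁅ q′ ⁆) 2≤n f
        (λ { zero → x∈p∪q⁺ (inj₁ (x∈⁅x⁆ p)) ; (suc zero) → x∈p∪q⁺ (inj₂ (x∈⁅x⁆ q′)) })
        (λ { zero → ∉pair (p≢p′ ∘ ≡.sym) p′≢q′ ; (suc zero) → ∉pair (p≢q ∘ ≡.sym) q≢q′ })
        (λ { zero zero _ → ≡.refl
           ; zero (suc zero) eq → contradiction eq u≉-u
           ; (suc zero) zero eq → contradiction (sym ∘ eq) u≉-u
           ; (suc zero) (suc zero) _ → ≡.refl })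
        (λ _ → 1#) (λ 1≋0 → 0≉1 (sym (1≋0 zero)))
        λ r → begin
          1# * (x p r + - x p′ r) + (1# * (x q′ r + - x q r) + 0#)  ≈⟨ +-cong (*-identityˡ _) (trans (+-identityʳ _) (*-identityˡ _)) ⟩
          (x p r + - x p′ r) + (x q′ r + - x q r)                   ≈⟨ +-congˡ (-u≋ r) ⟨
          (x p r + - x p′ r) + - (x p r + - x p′ r)                 ≈⟨ -‿inverseʳ _ ⟩
          0#                                                        ∎
      where
      f : Fin 2 → Edge k
      f zero    = p , p′
      f (suc _) = q′ , q

      ∉pair : ∀ {a} → a ≢ p → a ≢ q′ → a ∉ₛ ⁅ p ⁆ ∪ ⁅ q′ ⁆
      ∉pair a≢p a≢q′ a∈ = case x∈p∪q⁻ ⁅ p ⁆ ⁅ q′ ⁆ a∈ of λ where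
        (inj₁ a∈p)  → a≢p (x∈⁅y⁆⇒x≡y p a∈p)
        (inj₂ a∈q′) → a≢q′ (x∈⁅y⁆⇒x≡y q′ a∈q′)

      p′≢q′ : p′ ≢ q′
      -- If the subtracted points coincided, cancellation would give `x p ≋ x q`.
      p′≢q′ ≡.refl = p≢q (x-injective λ r → +-cancelʳ _ _ _ (u≋u′ r))

      -u≋ : ∀ r → - (x p r + - x p′ r) ≈ x q′ r + - x q r
      -u≋ r = trans (-‿cong (u≋u′ r)) (-[x-y]≈y-x _ _)

      u≉-u : ¬ (x p -ᵥ x p′ ≋ x q′ -ᵥ x q)
      u≉-u u≋-u = p≢p′ (x-injective λ r → x-y≈0⇒x≈y _ _ (x+x≈0⇒x≈0 (begin
        (x p r + - x p′ r) + (x p r + - x p′ r)    ≈⟨ +-congˡ (trans (u≋-u r) (sym (-u≋ r))) ⟩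
        (x p r + - x p′ r) + - (x p r + - x p′ r)  ≈⟨ -‿inverseʳ _ ⟩
        0#                                         ∎)))

    module _ (n<k : n ℕ.< k) {N} (N+n≤k : N ℕ.+ n ℕ.≤ k) (H : Fin N → Hyperplane n)
             (parallel : ∀ i j → H i ∥ H j) (covering : ∀ p → ∃[ i ] (x p ∈ₐ H i)) where

      private
        class : Fin k → Fin N
        class p = proj₁ (covering p)

      representative : Fin N → Fin k
      representative i with any? (λ p → class p ≟ i)
      ... | yes (p , _) = p
      -- A hyperplane to which no point is assigned gets an arbitrary default; `ρ` never meets it,
      -- since the class of a point is inhabited.
      ... | no _        = fromℕ< n<k

      class-representative : ∀ p → class (representative (class p)) ≡ class p
      class-representative p with any? (λ q → class q ≟ class p)
      ... | yes (_ , eq) = eq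
      ... | no none      = contradiction (p , ≡.refl) none

      private
        -- An idempotent map whose fixed points are the representatives of the nonempty classes; the
        -- points that it moves will form `I`.
        ρ : Fin k → Fin k
        ρ = representative ∘ class

        moved? : Decidable (λ p → ρ p ≢ p)
        moved? p = ¬? (ρ p ≟ p)

        ρρ≡ρ : ∀ p → ρ (ρ p) ≡ ρ p
        ρρ≡ρ p = ≡.cong representative (class-representative p)

        moved : List (Fin k)
        moved = filter moved? (allFin k)

      -- A fixed point of `ρ` is determined by its class and a moved one by its position in `moved`,
      -- so `k ≤ N + length moved`.
      n≤|moved| : n ℕ.≤ length moved
      n≤|moved| = ℕ.+-cancelˡ-≤ N _ _ (ℕ.≤-trans N+n≤k (injective⇒≤ {f = join N _ ∘ encode} λ {p} {q} eq →
          encode-injective p q (≡.trans (≡.sym (splitAt-join N _ (encode p)))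
            (≡.trans (≡.cong (splitAt N) eq) (splitAt-join N _ (encode q))))))
        where
        ∈-moved : ∀ {p} → ρ p ≢ p → p ∈ moved
        ∈-moved {p} = ∈-filter⁺ moved? (∈-allFin p)

        encode : Fin k → Fin N ⊎ Fin (length moved)
        encode p with ρ p ≟ p
        ... | yes _   = inj₁ (class p)
        ... | no ρp≢p = inj₂ (index (∈-moved ρp≢p))

        encode-injective : ∀ p q → encode p ≡ encode q → p ≡ q
        encode-injective p q eq with ρ p ≟ p | ρ q ≟ q
        ... | yes ρp≡p | yes ρq≡q = ≡.trans (≡.sym ρp≡p) (≡.trans (≡.cong representative (inj₁-injective eq)) ρq≡q)
        ... | no ρp≢p  | no ρq≢q  = ∈ₛ.index-injective (≡.setoid _) (∈-moved ρp≢p) (∈-moved ρq≢q) (inj₂-injective eq)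

      private
        ι : Fin n → Fin k
        ι i = lookup moved (inject≤ i n≤|moved|)

        ι-injective : ∀ {i j} → ι i ≡ ι j → i ≡ j
        ι-injective {i} {j} eq = inject≤-injective n≤|moved| n≤|moved| i j
          (unique⇒lookup-injective (≡.setoid _) (Unique.filter⁺ moved? (Unique.allFin⁺ k)) _ _ eq)

        ι-moved : ∀ i → ρ (ι i) ≢ ι i
        ι-moved i = proj₂ (∈-filter⁻ moved? {xs = allFin k} (∈-lookup (inject≤ i n≤|moved|)))

        I : Subset k
        I = comprehension moved?

        f : Fin n → Edge k
        f i = ι i , ρ (ι i)

        -- The base point cancels from `(x a - point) - (x b - point)`.
        -ᵥ-direction : ∀ {a b} i → x a ∈ₐ H i → x b ∈ₐ H i → AffineSubspace.direction (H i) (x a -ᵥ x b)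
        -ᵥ-direction {a} {b} i a∈H b∈H = resp
          (λ r → begin
            (x a r + - point r) + - 1# * (x b r + - point r)  ≈⟨ +-congˡ (-1*x≈-x _) ⟩
            (x a r + - point r) + - (x b r + - point r)       ≈⟨ +-congˡ (-[x-y]≈y-x _ _) ⟩
            (x a r + - point r) + (point r + - x b r)         ≈⟨ +-assoc _ _ _ ⟩
            x a r + (- point r + (point r + - x b r))         ≈⟨ +-congˡ (+-assoc _ _ _) ⟨
            x a r + (- point r + point r + - x b r)           ≈⟨ +-congˡ (+-congʳ (-‿inverseˡ _)) ⟩
            x a r + (0# + - x b r)                            ≈⟨ +-congˡ (+-identityˡ _) ⟩
            x a r + - x b r                                   ∎)
          (+-closed a∈H (*-closed (- 1#) b∈H))
          where
          open AffineSubspace (H i)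
          open IsLinearSubspace isLinearSubspace

        -- Any hyperplane of the family gives the common direction. An index in `Fin N` is obtained
        -- as the class of a point, which exists by `n < k`.
        H₀ : Hyperplane n
        H₀ = H (class (fromℕ< n<k))

        diff∈H₀ : ∀ i → AffineSubspace.direction H₀ (diff x (f i))
        diff∈H₀ i = proj₁ (parallel (class (ι i)) _) (-ᵥ-direction (class (ι i)) (proj₂ (covering (ι i)))
          (≡.subst (λ j → x (ρ (ι i)) ∈ₐ H j) (class-representative (ι i)) (proj₂ (covering (ρ (ι i))))))

        diff-distinct : ∀ i j → diff x (f i) ≋ diff x (f j) → i ≡ j
        diff-distinct i j eq with i ≟ j
        ... | yes i≡j = i≡j
        ... | no i≢j  = contradiction eq
          (differences-distinct (ι-moved i ∘ ≡.sym) (i≢j ∘ ι-injective) (ι-moved j ∘ ≡.sym))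

      ¬covered : ⊥
      ¬covered =
        let v , v≉0 , relation = subspace-relation (AffineSubspace.dimension H₀) (ℕ.∸-monoʳ-< (s≤s z≤n) (ℕ.<⇒≤ 2≤n))
                                   (diff x ∘ f) diff∈H₀
        in no-relation I ℕ.≤-refl f
             (λ i → ∈-comprehension⁺ moved? (ι-moved i))
             -- Representatives are fixed by `ρ`, hence lie outside `I`.
             (λ i ρι∈I → ∈-comprehension⁻ moved? ρι∈I (ρρ≡ρ (ι i)))
             diff-distinct v v≉0 relation

open import Data.Nat using (_+_; _≤_; _<_)

theorem1p3 : ∀ {c ℓ₁ ℓ₂} (ℝ : Reals c ℓ₁ ℓ₂) → let open Euclidean ℝ in
    ∀ (n k : ℕ) → n < k →
    (x : Fin k → ℝ^ n) → Injective _≡_ _≋_ x →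
    (m l : ℕ) → 1 ≤ m → 1 ≤ l → k ≡ m + l →
    (I J : Subset k) → IsPartition I J → ∣ I ∣ ≡ m → ∣ J ∣ ≡ l →
    (D : FiniteSet n) → D ⊆ 𝒟 x I J →
    (ℓ : ℕ) → 1 ≤ ℓ → ℓ ≤ n ∸ 1 →
    ( NotCoveredByFewerThan x (k ∸ n + 1) →
      ((D′ : FiniteSet n) → D′ ⊆ D → card D′ ≡ ℓ → GirthExceeds (Γ x I J D′) ℓ) →
      -- D itself takes the place of the ℓ-element subsets when it has none.
      (card D < ℓ → GirthExceeds (Γ x I J D) ℓ) →
      IsSensing ℓ (A D) )
    ×
    ( ((m′ l′ : ℕ) → 1 ≤ m′ → 1 ≤ l′ → m′ + l′ ≡ k →
       (I′ J′ : Subset k) → IsPartition I′ J′ → ∣ I′ ∣ ≡ m′ → ∣ J′ ∣ ≡ l′ →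
       IsSensing n (A (𝒟 x I′ J′))) →
      NotCoveredByFewerThan x (k ∸ n + 1) )
theorem1p3 ℝ n k n<k x x-injective m l _ _ _ I J I⊔J _ _ D D⊆𝒟 ℓ 1≤ℓ ℓ≤n-1 =
    (λ not-covered girth girth-small →
      sensing n<k x I J I⊔J D D⊆𝒟 ℓ ℓ≤n-1 not-covered girth girth-small)
  , λ all-sensing N N<k-n+1 (H , parallel , covering) →
      ¬covered x x-injective 2≤n
        (λ I′ p∈I′ q∉I′ → all-sensing _ _ (0<∣p∣ p∈I′) (0<∣p∣ (x∉p⇒x∈∁p q∉I′)) (∣p∣+∣∁p∣≡n I′)
                            I′ (∁ I′) (∁-isPartition I′) ≡.refl ≡.refl)
        n<k (ℕ.m≤o∸n⇒m+n≤o N (ℕ.<⇒≤ n<k) (ℕ.≤-pred (≡.subst (N <_) (ℕ.+-comm _ 1) N<k-n+1)))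
        H parallel covering
  where
  open Geometry ℝ
  -- `1 ≤ ℓ ≤ n ∸ 1` forces `n ≥ 2`, so sensing for `n`-sparse vectors excludes relations between
  -- two columns.
  2≤n : 2 ≤ n
  2≤n = ℕ.m≤o∸n⇒m+n≤o 1 1≤n (ℕ.≤-trans 1≤ℓ ℓ≤n-1)
    where
    1≤n : 1 ≤ n
    1≤n = ℕ.≤-trans 1≤ℓ (ℕ.≤-trans ℓ≤n-1 (ℕ.m∸n≤m n 1))
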